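{- There exists a connected cubic graph $G$ on fifty vertices such that $G$ has a unique minimum maximal matching, this matching admits no dominating transversal, and yet $\gamma(G) = 14 < 15 = \gamma_e(G)$.
   Context: Graphs are finite, simple and undirected; cubic means $3$-regular. The domination number $\gamma(G)$ is the minimum size of a set $S$ of vertices such that every vertex outside $S$ has a neighbour in $S$. A matching is a set of edges no two of which share a vertex; it is maximal if no edge of $G$ can be added to it. The edge domination number $\gamma_e(G)$ is the minimum size of a maximal matching of $G$, and a minimum maximal matching is a maximal matching of size $\gamma_e(G)$. For a matching $M$, $V(M)$ is the set of vertices lying on edges of $M$; the other vertices are unsaturated by $M$. A transversal of $M$ is a set $T \subseteq V(M)$ containing exactly one endpoint of each edge of $M$. A transversal $T$ is dominating if every vertex of $G$ unsaturated by $M$ has a neighbour in $T$. -}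

module Defs where

open import Level using (0ℓ)
open import Data.Nat.Base using (ℕ; _≤_)
open import Data.Fin.Base using (Fin; _<_)
open import Data.Fin.Subset using (Subset; _∈_; _∉_; ∣_∣)
open import Data.List.Base using (List; _∷_; length)
open import Data.List.Membership.Propositional using () renaming (_∉_ to _∉ₗ_)
open import Data.List.Relation.Binary.BagAndSetEquality using (_∼[_]_; set)
open import Data.List.Relation.Unary.All using (All)
open import Data.List.Relation.Unary.AllPairs using (AllPairs)
open import Data.List.Relation.Unary.Any using (Any)
open import Data.Product.Base using (_×_; _,_; ∃-syntax)
open import Data.Sum.Base using (_⊎_)
open import Data.Vec.Base using (tabulate)
open import Relation.Binary.Construct.Closure.ReflexiveTransitive using (Star)
open import Relation.Binary.Core using (Rel)
open import Relation.Binary.Definitions using (Decidable; Irreflexive; Symmetric)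
open import Relation.Binary.PropositionalEquality using (_≡_)
open import Relation.Nullary.Decidable.Core using (does)
open import Relation.Nullary.Negation.Core using (¬_)

record Graph (n : ℕ) : Set₁ where
  field
    Adj    : Rel (Fin n) 0ℓ
    adj?   : Decidable Adj
    sym    : Symmetric Adj
    irrefl : Irreflexive _≡_ Adj

  neighbours : Fin n → Subset n
  neighbours v = tabulate (λ u → does (adj? v u))

  degree : Fin n → ℕ
  degree v = ∣ neighbours v ∣

open Graph public using (Adj; degree)

IsMinimum : (ℕ → Set) → ℕ → Set
IsMinimum P k = P k × (∀ j → P j → k ≤ j)

-- An unordered pair of distinct vertices is stored once, smaller vertex first
-- (see IsEdge).
VertexPair : ℕ → Set
VertexPair n = Fin n × Fin n

_endpointOf_ : ∀ {n} → Fin n → VertexPair n → Set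
x endpointOf (u , v) = x ≡ u ⊎ x ≡ v

DisjointEdges : ∀ {n} → VertexPair n → VertexPair n → Set
DisjointEdges e f = ∀ x → ¬ (x endpointOf e × x endpointOf f)

Saturated : ∀ {n} → List (VertexPair n) → Fin n → Set
Saturated M x = Any (x endpointOf_) M

IsTransversal : ∀ {n} → List (VertexPair n) → Subset n → Set
IsTransversal M T =
  (∀ x → x ∈ T → Saturated M x) ×
  All (λ { (u , v) → (u ∈ T × v ∉ T) ⊎ (u ∉ T × v ∈ T) }) M

module _ {n : ℕ} (G : Graph n) where

  Cubic : Set
  Cubic = ∀ v → degree G v ≡ 3

  -- Any two vertices are joined by a walk; this holds for the empty graph too.
  Connected : Set
  Connected = ∀ u v → Star (Adj G) u v

  IsDominating : Subset n → Set
  IsDominating S = ∀ v → v ∉ S → ∃[ u ] (u ∈ S × Adj G v u)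

  IsDominationNumber : ℕ → Set
  IsDominationNumber = IsMinimum (λ k → ∃[ S ] (IsDominating S × ∣ S ∣ ≡ k))

  IsEdge : VertexPair n → Set
  IsEdge (u , v) = u < v × Adj G u v

  -- Pairwise disjointness rules out repeated entries, so length M is the
  -- number of edges of M.
  IsMatching : List (VertexPair n) → Set
  IsMatching M = All IsEdge M × AllPairs DisjointEdges M

  IsMaximalMatching : List (VertexPair n) → Set
  IsMaximalMatching M =
    IsMatching M × (∀ e → IsEdge e → e ∉ₗ M → ¬ IsMatching (e ∷ M))

  IsEdgeDominationNumber : ℕ → Set
  IsEdgeDominationNumber =
    IsMinimum (λ k → ∃[ M ] (IsMaximalMatching M × length M ≡ k))

  IsMinimumMaximalMatching : List (VertexPair n) → Set
  IsMinimumMaximalMatching M =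
    IsMaximalMatching M × IsEdgeDominationNumber (length M)

  -- Lists enumerate edge sets in some order, so uniqueness is up to having the
  -- same members.
  IsUniqueMinimumMaximalMatching : List (VertexPair n) → Set
  IsUniqueMinimumMaximalMatching M =
    IsMinimumMaximalMatching M ×
    (∀ M′ → IsMinimumMaximalMatching M′ → M′ ∼[ set ] M)

  IsDominatingTransversal : List (VertexPair n) → Subset n → Set
  IsDominatingTransversal M T =
    IsTransversal M T ×
    (∀ v → ¬ Saturated M v → ∃[ u ] (u ∈ T × Adj G v u))

{-# OPTIONS --safe #-}
module Submission where

-- Take a 3-CNF formula with 15 variables and 20 clauses in which every literal
-- occurs exactly twice. Its literals and clauses, with an edge from each literal
-- to its negation and to the two clauses containing it, form a cubic graph on
-- fifty vertices. The literal–negation edges form a matching M that dominates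
-- each of the 75 edges exactly once; no edge dominates more than five, so M is a
-- minimum maximal matching. A transversal of M is a truth assignment, and it is
-- dominating iff it satisfies the formula, so an unsatisfiable formula leaves
-- none. Following Berman, Karpinski and Scott, each of the clauses x ∨ x ∨ y,
-- x̄ ∨ x̄ ∨ y, ȳ ∨ z ∨ z, ȳ ∨ z̄ ∨ z̄ is expanded into a gadget of five clauses on
-- three fresh variables. That M is the only minimum maximal matching and that no
-- 13 vertices dominate the graph is established by branch and bound.

open import Defs
open import Data.Bool.Base using (T; true; false; if_then_else_)
open import Data.Empty using (⊥; ⊥-elim)
open import Data.Fin.Base using (Fin; zero; suc; combine; _↑ˡ_; _↑ʳ_)
open import Data.Fin using (#_)
import Data.Fin.Properties as Finₚ
open import Data.Fin.Subset using (Subset; ∣_∣) renaming (_∈_ to _∈ₛ_)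
open import Data.Fin.Subset.Properties using () renaming (_∈?_ to _∈ₛ?_)
open import Data.List.Base
  using (List; []; _∷_; _++_; length; filter; map; concatMap; allFin)
open import Data.List.Membership.Propositional using (_∈_; find; lose)
open import Data.List.Membership.Propositional.Properties
  using (∈-∃++; ∈-filter⁺; ∈-filter⁻; ∈-concatMap⁺; ∈-map⁺; ∈-allFin)
open import Data.List.Properties using (length-++; length-map)
open import Data.List.Relation.Binary.BagAndSetEquality using (bag-=⇒; ↭⇒∼bag)
open import Data.List.Relation.Binary.Permutation.Propositional
  using (_↭_; ↭-refl; ↭-trans; prep)
open import Data.List.Relation.Binary.Permutation.Propositional.Properties
  using (shift; ↭-length; All-resp-↭; Any-resp-↭)
open import Data.List.Relation.Binary.Sublist.Propositional using (_⊆_; ⊆-refl; ⊆-trans)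
open import Data.List.Relation.Binary.Sublist.Propositional.Properties
  using (filter-⊆; length-mono-≤) renaming (filter⁺ to ⊆-filter⁺)
open import Data.List.Relation.Ternary.Interleaving.Propositional using (toPermutation)
import Data.List.Relation.Ternary.Interleaving.Setoid.Properties as Interleaving
open import Data.List.Relation.Unary.All as All using (All; []; _∷_; all?)
import Data.List.Relation.Unary.All.Properties as Allₚ
open import Data.List.Relation.Unary.AllPairs as AllPairs using (AllPairs; _∷_; allPairs?)
open import Data.List.Relation.Unary.Any as Any using (Any; here; there; any?)
open import Data.List.Relation.Unary.Any.Properties using (map⁺; concatMap⁺)
open import Data.Nat.Base using (ℕ; zero; suc; _+_; _*_; _≤_; _<_; z≤n; _<ᵇ_)
open import Data.Nat.Properties
  using (_≟_; _≤?_; ≤-refl; ≤-reflexive; ≤-trans; ≤-pred; <⇒≱; ≮⇒≥; <ᵇ⇒<; +-mono-≤; *-suc;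
    *-monoʳ-≤; *-cancelˡ-≤; m+1+n≰m; module ≤-Reasoning)
open import Data.Product.Base using (Σ; _×_; ∃-syntax; _,_)
open import Data.Sum.Base as Sum using (_⊎_; inj₁; inj₂; [_,_])
open import Data.Vec.Base as Vec using (Vec; []; _∷_; here; there; lookup)
open import Function.Base using (_∘_; case_of_; id)
open import Level using (0ℓ)
open import Relation.Binary.Construct.Closure.ReflexiveTransitive
  using (Star; ε; _◅_; _◅◅_; reverse)
open import Relation.Binary.Core using (Rel)
open import Relation.Binary.Definitions using (Decidable)
open import Relation.Binary.PropositionalEquality
  using (_≡_; refl; sym; trans; cong; subst; setoid)
open import Relation.Nullary.Decidable
  using (Dec; yes; no; does; from-yes; ¬?; _×-dec_; _⊎-dec_; _→-dec_)
open import Relation.Nullary.Negation.Core using (¬_; contradiction)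
open import Data.List.Membership.DecPropositional (Finₚ._≟_ {50}) using (_∈?_)

-- Covering a finite set by bounded neighbourhoods.

length-filter-¬ : ∀ {A : Set} {P : A → Set} (P? : ∀ x → Dec (P x)) xs →
  length xs ≡ length (filter P? xs) + length (filter (¬? ∘ P?) xs)
length-filter-¬ P? xs =
  trans (↭-length (toPermutation (Interleaving.filter⁺ (setoid _) P? xs))) (length-++ (filter P? xs))

module Covering {A : Set} (U : List A) {_~_ : Rel A 0ℓ} (_~?_ : Decidable _~_) (s : ℕ)
  (bounded : All (λ w → length (filter (w ~?_) U) ≤ s) U) where

  Covers : List A → List A → Set
  Covers L R = All (λ r → Any (_~ r) L) R

  uncovered : A → List A → List A
  uncovered w = filter (λ r → ¬? (w ~? r))

  uncovered-⊆ : ∀ w {R} → R ⊆ U → uncovered w R ⊆ U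
  uncovered-⊆ w R⊆U = ⊆-trans (filter-⊆ (λ r → ¬? (w ~? r)) _) R⊆U

  Covers-uncovered : ∀ {w L R} → Covers (w ∷ L) R → Covers L (uncovered w R)
  Covers-uncovered {w} cov = All.tabulate λ r∈ →
    case ∈-filter⁻ (λ r → ¬? (w ~? r)) r∈ of λ where
      (r∈R , w≁r) → Any.tail w≁r (All.lookup cov r∈R)

  -- Induction on `L`: since `R` is a sublist of `U`, the head `w` covers at most `s` points of `R`,
  -- and the tail covers whatever `w` leaves.
  Covers-size : ∀ {L R} → All (_∈ U) L → R ⊆ U → Covers L R → length R ≤ s * length L
  Covers-size {[]} {[]} _ _ _ = z≤n
  Covers-size {[]} {_ ∷ _} _ _ (() ∷ _)
  Covers-size {w ∷ L} {R} (w∈U ∷ L⊆U) R⊆U cov = begin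
    length R                                            ≡⟨ length-filter-¬ (w ~?_) R ⟩
    length (filter (w ~?_) R) + length (uncovered w R)  ≤⟨ +-mono-≤ near far ⟩
    s + s * length L                                    ≡⟨ *-suc s (length L) ⟨
    s * suc (length L)                                  ∎
    where
    open ≤-Reasoning
    near : length (filter (w ~?_) R) ≤ s
    near = ≤-trans (length-mono-≤ (⊆-filter⁺ (w ~?_) (w ~?_) (λ { refl p → p }) R⊆U))
                   (All.lookup bounded w∈U)
    far : length (uncovered w R) ≤ s * length L
    far = Covers-size L⊆U (uncovered-⊆ w R⊆U) (Covers-uncovered cov)

  -- Branch and bound: some chosen point must cover the first uncovered one, and
  -- k points cannot cover more than s * k.
  mutual
    coverings : ℕ → List A → List (List A)
    coverings k R = if s * k <ᵇ length R then [] else branch k R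

    branch : ℕ → List A → List (List A)
    branch k       []      = [] ∷ []
    branch zero    (_ ∷ _) = []
    branch (suc k) (r ∷ R) =
      concatMap (λ w → map (w ∷_) (coverings k (uncovered w (r ∷ R)))) (filter (_~? r) U)

  -- The search stops as soon as nothing is left uncovered, so the covering it returns may be
  -- shorter than `L`; `L′` holds the surplus.
  _Extends_ : List A → List A → Set
  L Extends S = ∃[ L′ ] L ↭ S ++ L′

  mutual
    -- Pruning would contradict `Covers-size`. Otherwise some point of `L` covers the first
    -- uncovered point, so it is among those tried, and the rest of `L` covers what it leaves.
    coverings-complete : ∀ k {L R} → All (_∈ U) L → R ⊆ U → length L ≤ k → Covers L R →
      Any (L Extends_) (coverings k R)
    coverings-complete k {L} {R} L⊆U R⊆U ∣L∣≤k cov with s * k <ᵇ length R in eq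
    ... | false = branch-complete k L⊆U R⊆U ∣L∣≤k cov
    ... | true  = contradiction
      (≤-trans (Covers-size L⊆U R⊆U cov) (*-monoʳ-≤ s ∣L∣≤k))
      (<⇒≱ (<ᵇ⇒< (s * k) (length R) (subst T (sym eq) _)))

    branch-complete : ∀ k {L R} → All (_∈ U) L → R ⊆ U → length L ≤ k → Covers L R →
      Any (L Extends_) (branch k R)
    branch-complete k       {L} {[]} _ _ _ _ = here (L , ↭-refl)
    branch-complete zero    {[]} {r ∷ R} _ _ _ (() ∷ _)
    branch-complete (suc k) {L} {r ∷ R} L⊆U R⊆U ∣L∣≤k cov
      with w , w∈L , w~r ← find (All.head cov)
      with ys , zs , refl ← ∈-∃++ w∈L =
      concatMap⁺ _ (lose (∈-filter⁺ (_~? r) (All.lookup L⊆U w∈L) w~r)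
        (map⁺ (Any.map (λ (L′ , p) → L′ , ↭-trans L↭ (prep w p))
          (coverings-complete k (All.tail (All-resp-↭ L↭ L⊆U)) (uncovered-⊆ w R⊆U)
            (≤-pred (≤-trans (≤-reflexive (sym (↭-length L↭))) ∣L∣≤k))
            (Covers-uncovered (All.map (Any-resp-↭ L↭) cov))))))
      where
      L↭ : L ↭ w ∷ ys ++ zs
      L↭ = shift w ys zs

-- Subsets as lists.

elements : ∀ {n} → Subset n → List (Fin n)
elements []          = []
elements (true  ∷ S) = zero ∷ map suc (elements S)
elements (false ∷ S) = map suc (elements S)

length-elements : ∀ {n} (S : Subset n) → length (elements S) ≡ ∣ S ∣
length-elements []          = refl
length-elements (true  ∷ S) = cong suc (trans (length-map suc (elements S)) (length-elements S))
length-elements (false ∷ S) = trans (length-map suc (elements S)) (length-elements S)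

∈-elements : ∀ {n x} (S : Subset n) → x ∈ₛ S → x ∈ elements S
∈-elements (true  ∷ S) here        = here refl
∈-elements (true  ∷ S) (there x∈S) = there (∈-map⁺ suc (∈-elements S x∈S))
∈-elements (false ∷ S) (there x∈S) = ∈-map⁺ suc (∈-elements S x∈S)

-- The graph of the formula.

-- Vertices 11g + i with i < 11 form gadget g: its literals a, ā, b, b̄, c, c̄ are
-- i = 0 to 5 and its clauses are i = 6 to 10. Vertices 44 to 49 are x, x̄, y, ȳ, z, z̄.
inner : Fin 4 → Fin 11 → Fin 50
inner g i = combine g i ↑ˡ 6

outer : Fin 6 → Fin 50
outer i = 44 ↑ʳ i

-- Each literal of the gadget lies in exactly one of `p`, `p̄` and in exactly one of `q₁`, `q₂`,
-- `q₃`; the latter three also receive `l₁`, `l₂`, `l₃`.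
gadget : Fin 4 → (l₁ l₂ l₃ : Fin 50) → Vec (List (Fin 50)) 11
gadget g l₁ l₂ l₃ =
  (ā ∷ p ∷ q₃ ∷ []) ∷ (a ∷ p̄ ∷ q₁ ∷ []) ∷
  (b̄ ∷ p ∷ q₁ ∷ []) ∷ (b ∷ p̄ ∷ q₂ ∷ []) ∷
  (c̄ ∷ p ∷ q₂ ∷ []) ∷ (c ∷ p̄ ∷ q₃ ∷ []) ∷
  (a ∷ b ∷ c ∷ []) ∷ (ā ∷ b̄ ∷ c̄ ∷ []) ∷
  (l₁ ∷ ā ∷ b ∷ []) ∷ (l₂ ∷ b̄ ∷ c ∷ []) ∷ (l₃ ∷ c̄ ∷ a ∷ []) ∷ []
  where
  a  = inner g (# 0)
  ā  = inner g (# 1)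
  b  = inner g (# 2)
  b̄  = inner g (# 3)
  c  = inner g (# 4)
  c̄  = inner g (# 5)
  p  = inner g (# 6)
  p̄  = inner g (# 7)
  q₁ = inner g (# 8)
  q₂ = inner g (# 9)
  q₃ = inner g (# 10)

x x̄ y ȳ z z̄ : Fin 50
x = outer (# 0)
x̄ = outer (# 1)
y = outer (# 2)
ȳ = outer (# 3)
z = outer (# 4)
z̄ = outer (# 5)

neighbourTable : Vec (List (Fin 50)) 50
neighbourTable =
  gadget (# 0) x x y Vec.++ gadget (# 1) x̄ x̄ y Vec.++
  gadget (# 2) ȳ z z Vec.++ gadget (# 3) ȳ z̄ z̄ Vec.++
  -- After its negation, each outer literal lists the two clauses in which the gadgets above use it
  -- as an `lᵢ`.
  (x̄ ∷ inner (# 0) (# 8) ∷ inner (# 0) (# 9) ∷ []) ∷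
  (x ∷ inner (# 1) (# 8) ∷ inner (# 1) (# 9) ∷ []) ∷
  (ȳ ∷ inner (# 0) (# 10) ∷ inner (# 1) (# 10) ∷ []) ∷
  (y ∷ inner (# 2) (# 8) ∷ inner (# 3) (# 8) ∷ []) ∷
  (z̄ ∷ inner (# 2) (# 9) ∷ inner (# 2) (# 10) ∷ []) ∷
  (z ∷ inner (# 3) (# 9) ∷ inner (# 3) (# 10) ∷ []) ∷ []

nbrs : Fin 50 → List (Fin 50)
nbrs = lookup neighbourTable

nbrs-sym : ∀ u → All (λ v → u ∈ nbrs v) (nbrs u)
nbrs-sym = from-yes (Finₚ.all? λ u → all? (λ v → u ∈? nbrs v) (nbrs u))

nbrs-irrefl : ∀ u → ¬ u ∈ nbrs u
nbrs-irrefl = from-yes (Finₚ.all? λ u → ¬? (u ∈? nbrs u))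

G : Graph 50
G = record
  { Adj    = λ u v → v ∈ nbrs u
  ; adj?   = λ u v → v ∈? nbrs u
  ; sym    = λ {u} → All.lookup (nbrs-sym u)
  ; irrefl = λ { refl → nbrs-irrefl _ }
  }

-- Regularity and connectedness.

cubic : Cubic G
cubic = from-yes (Finₚ.all? λ v → degree G v ≟ 3)

ReachesIn : ℕ → Fin 50 → Set
ReachesIn zero    u = u ≡ y
ReachesIn (suc k) u = u ≡ y ⊎ Any (ReachesIn k) (nbrs u)

reachesIn? : ∀ k u → Dec (ReachesIn k u)
reachesIn? zero    u = u Finₚ.≟ y
reachesIn? (suc k) u = u Finₚ.≟ y ⊎-dec any? (reachesIn? k) (nbrs u)

ReachesIn⇒Star : ∀ k {u} → ReachesIn k u → Star (Adj G) u y
ReachesIn⇒Star zero    refl        = ε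
ReachesIn⇒Star (suc k) (inj₁ refl) = ε
ReachesIn⇒Star (suc k) (inj₂ hit)  with v , v∈ , r ← find hit = v∈ ◅ ReachesIn⇒Star k r

connected : Connected G
connected u v = toY u ◅◅ reverse (Graph.sym G) (toY v)
  where
  toY : ∀ w → Star (Adj G) w y
  -- Every vertex is within distance 6 of `y`, which is adjacent to gadgets 0 and 1 and linked
  -- through `ȳ` to gadgets 2 and 3.
  toY w = ReachesIn⇒Star 6 (from-yes (Finₚ.all? (reachesIn? 6)) w)

-- The domination number.

_~_ : Rel (Fin 50) 0ℓ
u ~ v = u ≡ v ⊎ v ∈ nbrs u

_~?_ : Decidable _~_
u ~? v = u Finₚ.≟ v ⊎-dec v ∈? nbrs u

closedNbhd≤4 : All (λ w → length (filter (w ~?_) (allFin 50)) ≤ 4) (allFin 50)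
closedNbhd≤4 = from-yes (all? (λ w → length (filter (w ~?_) (allFin 50)) ≤? 4) (allFin 50))

module Dom = Covering (allFin 50) _~?_ 4 closedNbhd≤4

-- Counting alone does not exclude 13, as 4 · 13 = 52 ≥ 50. But it leaves a slack of only two, so
-- the search prunes early enough to be evaluated.
no-13-covering : Dom.coverings 13 (allFin 50) ≡ []
no-13-covering = refl

dominating⇒covers : ∀ {S} → IsDominating G S → Dom.Covers (elements S) (allFin 50)
dominating⇒covers {S} dom = All.tabulate λ {v} _ → dominator v
  where
  dominator : ∀ v → Any (_~ v) (elements S)
  dominator v with v ∈ₛ? S
  ... | yes v∈S = lose (∈-elements S v∈S) (inj₁ refl)
  ... | no  v∉S with u , u∈S , v~u ← dom v v∉S =
    lose (∈-elements S u∈S) (inj₂ (Graph.sym G v~u))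

dominating⇒14≤ : ∀ {S} → IsDominating G S → 14 ≤ ∣ S ∣
dominating⇒14≤ {S} dom = ≮⇒≥ λ ∣S∣<14 →
  case subst (Any _) no-13-covering
    (Dom.coverings-complete 13 (All.tabulate λ {v} _ → ∈-allFin v) ⊆-refl
      (≤-trans (≤-reflexive (length-elements S)) (≤-pred ∣S∣<14)) (dominating⇒covers dom))
  of λ ()

-- Once l₁, l₂ and l₃ are chosen, p and p̄ dominate the rest of a gadget. This
-- serves every gadget but the second, whose literal x̄ is not chosen.
D : Subset 50
D = Vec.tabulate λ v → does (v ∈? dominators)
  where
  dominators : List (Fin 50)
  dominators =
    x ∷ y ∷ ȳ ∷ z ∷ z̄ ∷ inner (# 0) (# 6) ∷ inner (# 0) (# 7) ∷
    inner (# 1) (# 1) ∷ inner (# 1) (# 3) ∷ inner (# 1) (# 4) ∷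
    inner (# 2) (# 6) ∷ inner (# 2) (# 7) ∷ inner (# 3) (# 6) ∷ inner (# 3) (# 7) ∷ []

D-dominating : IsDominating G D
D-dominating v v∉D = case find (dominated v v∉D) of λ (u , u∈ , u∈D) → u , u∈D , u∈
  where
  dominated : ∀ v → ¬ v ∈ₛ D → Any (_∈ₛ D) (nbrs v)
  dominated = from-yes (Finₚ.all? λ v → ¬? (v ∈ₛ? D) →-dec any? (_∈ₛ? D) (nbrs v))

dominationNumber : IsDominationNumber G 14
dominationNumber = (D , D-dominating , refl) , λ { _ (S , dom , refl) → dominating⇒14≤ dom }

-- Maximal matchings and the edge domination number.

IsEdge? : ∀ e → Dec (IsEdge G e)
IsEdge? (u , v) = u Finₚ.<? v ×-dec v ∈? nbrs u

edgesUpTo : Fin 50 → List (VertexPair 50)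
edgesUpTo v = map (_, v) (filter (Finₚ._<? v) (nbrs v))

edges : List (VertexPair 50)
edges = concatMap edgesUpTo (allFin 50)

edges-complete : ∀ {e} → IsEdge G e → e ∈ edges
edges-complete {u , v} (u<v , v∈) = ∈-concatMap⁺ edgesUpTo
  (lose (∈-allFin v) (∈-map⁺ (_, v) (∈-filter⁺ (Finₚ._<? v) (Graph.sym G {u} v∈) u<v)))

endpointOf? : Decidable (_endpointOf_ {50})
endpointOf? w (u , v) = w Finₚ.≟ u ⊎-dec w Finₚ.≟ v

-- An edge meets itself, so covering all edges under this relation is edge domination.
Meets : Rel (VertexPair 50) 0ℓ
Meets (u , v) f = u endpointOf f ⊎ v endpointOf f

meets? : Decidable Meets
meets? (u , v) f = endpointOf? u f ⊎-dec endpointOf? v f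

¬Meets⇒Disjoint : ∀ {e f} → ¬ Meets e f → DisjointEdges e f
¬Meets⇒Disjoint ¬m _ (inj₁ refl , w∈f) = ¬m (inj₁ w∈f)
¬Meets⇒Disjoint ¬m _ (inj₂ refl , w∈f) = ¬m (inj₂ w∈f)

Meets⇒¬Disjoint : ∀ {e f} → Meets e f → ¬ DisjointEdges e f
Meets⇒¬Disjoint (inj₁ u∈f) dis = dis _ (inj₁ refl , u∈f)
Meets⇒¬Disjoint (inj₂ v∈f) dis = dis _ (inj₂ refl , v∈f)

Meets-sym : ∀ {e f} → Meets e f → Meets f e
Meets-sym (inj₁ (inj₁ refl)) = inj₁ (inj₁ refl)
Meets-sym (inj₁ (inj₂ refl)) = inj₂ (inj₁ refl)
Meets-sym (inj₂ (inj₁ refl)) = inj₁ (inj₂ refl)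
Meets-sym (inj₂ (inj₂ refl)) = inj₂ (inj₂ refl)

closedEdgeNbhd≤5 : All (λ e → length (filter (meets? e) edges) ≤ 5) edges
closedEdgeNbhd≤5 = from-yes (all? (λ e → length (filter (meets? e) edges) ≤? 5) edges)

module EdgeDom = Covering edges meets? 5 closedEdgeNbhd≤5

edges-sound : All (IsEdge G) edges
edges-sound = from-yes (all? IsEdge? edges)

-- An edge met by no edge of `M` could be added to `M`.
maximal⇒covers : ∀ {M} → IsMaximalMatching G M → EdgeDom.Covers M edges
maximal⇒covers {M} ((M⊆E , disjoint) , maximal) = All.map met edges-sound
  where
  met : ∀ {e} → IsEdge G e → Any (λ f → Meets f e) M
  met {e} isEdge with any? (λ f → meets? f e) M
  ... | yes m = m
  ... | no ¬m = contradiction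
    ( isEdge ∷ M⊆E
    , All.tabulate (λ f∈M → ¬Meets⇒Disjoint (λ m → ¬m (lose f∈M (Meets-sym m)))) ∷ disjoint )
    (maximal e isEdge λ e∈M → ¬m (lose e∈M (inj₁ (inj₁ refl))))

M₀ : List (VertexPair 50)
M₀ = concatMap (λ g → literalPair g (# 0) (# 1) ∷ literalPair g (# 2) (# 3) ∷ literalPair g (# 4) (# 5) ∷ []) (allFin 4)
  ++ (x , x̄) ∷ (y , ȳ) ∷ (z , z̄) ∷ []
  where
  literalPair : Fin 4 → Fin 11 → Fin 11 → VertexPair 50
  literalPair g i j = inner g i , inner g j

-- With 75 = 5 · 15 edges there is no slack: a branch survives only if each chosen edge meets five
-- edges not yet covered. `M₀` is listed in the order in which the search finds it.
unique-15-covering : EdgeDom.coverings 15 edges ≡ M₀ ∷ []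
unique-15-covering = refl

meets⇒unaddable : ∀ {e M} → Any (Meets e) M → ¬ IsMatching G (e ∷ M)
meets⇒unaddable m (_ , e∥M ∷ _) with f , f∈M , m′ ← find m =
  Meets⇒¬Disjoint m′ (All.lookup e∥M f∈M)

M₀-disjoint : AllPairs (λ e f → ¬ Meets e f) M₀
M₀-disjoint = from-yes (allPairs? (λ e f → ¬? (meets? e f)) M₀)

M₀-meets-edges : All (λ e → Any (Meets e) M₀) edges
M₀-meets-edges = from-yes (all? (λ e → any? (meets? e) M₀) edges)

M₀-edges : All (IsEdge G) M₀
M₀-edges = from-yes (all? IsEdge? M₀)

M₀-maximal : IsMaximalMatching G M₀
M₀-maximal = (M₀-edges , AllPairs.map ¬Meets⇒Disjoint M₀-disjoint) ,
  λ _ isEdge _ → meets⇒unaddable (All.lookup M₀-meets-edges (edges-complete isEdge))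

IsMaximalMatching⇒⊆edges : ∀ {M} → IsMaximalMatching G M → All (_∈ edges) M
IsMaximalMatching⇒⊆edges ((M⊆E , _) , _) = All.map edges-complete M⊆E

edgeDominationNumber : IsEdgeDominationNumber G 15
edgeDominationNumber = (M₀ , M₀-maximal , refl) , λ where
  -- The 75 edges give `5 * 15 ≤ 5 * length M`.
  _ (M , max , refl) → *-cancelˡ-≤ 5
    (EdgeDom.Covers-size (IsMaximalMatching⇒⊆edges max) ⊆-refl (maximal⇒covers max))

M₀-unique : IsUniqueMinimumMaximalMatching G M₀
M₀-unique = (M₀-maximal , edgeDominationNumber) , λ M (max , _ , least) →
  let ∣M∣≤15 = least 15 (M₀ , M₀-maximal , refl) in
  case subst (Any (M EdgeDom.Extends_)) unique-15-covering
    (EdgeDom.coverings-complete 15 (IsMaximalMatching⇒⊆edges max) ⊆-refl ∣M∣≤15 (maximal⇒covers max))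
  of λ where
    -- `M` is a permutation of `M₀ ++ L′`, and a nonempty `L′` would make it longer than 15.
    (here ([]    , M↭)) → bag-=⇒ (↭⇒∼bag M↭)
    (here (_ ∷ _ , M↭)) → contradiction (subst (_≤ 15) (↭-length M↭) ∣M∣≤15) (m+1+n≰m 15)

-- Unsatisfiability and transversals.

triple : ∀ {A : Set} {P : A → Set} {u v w} → Any P (u ∷ v ∷ w ∷ []) → P u ⊎ P v ⊎ P w
triple (here p)                 = inj₁ p
triple (there (here p))         = inj₂ (inj₁ p)
triple (there (there (here p))) = inj₂ (inj₂ p)

-- If every lᵢ fails, the last three clauses say a ⇒ b ⇒ c ⇒ a, so a, b and c are
-- all true or all false, against the first two clauses.
enforcer : ∀ {A : Set} {P : A → Set} {a ā b b̄ c c̄ l₁ l₂ l₃} →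
  ¬ (P a × P ā) → ¬ (P b × P b̄) → ¬ (P c × P c̄) →
  All (Any P) ((a ∷ b ∷ c ∷ []) ∷ (ā ∷ b̄ ∷ c̄ ∷ []) ∷
    (l₁ ∷ ā ∷ b ∷ []) ∷ (l₂ ∷ b̄ ∷ c ∷ []) ∷ (l₃ ∷ c̄ ∷ a ∷ []) ∷ []) →
  P l₁ ⊎ P l₂ ⊎ P l₃
enforcer {P = P} {a} {ā} {b} {b̄} {c} {c̄} {l₁} {l₂} {l₃} ¬a ¬b ¬c (k ∷ k̄ ∷ k₁ ∷ k₂ ∷ k₃ ∷ []) =
  split (triple k₁) (triple k₂) (triple k₃)
  where
  split : P l₁ ⊎ P ā ⊎ P b → P l₂ ⊎ P b̄ ⊎ P c → P l₃ ⊎ P c̄ ⊎ P a → P l₁ ⊎ P l₂ ⊎ P l₃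
  split (inj₁ l) _ _ = inj₁ l
  split (inj₂ _) (inj₁ l) _ = inj₂ (inj₁ l)
  split (inj₂ _) (inj₂ _) (inj₁ l) = inj₂ (inj₂ l)
  split (inj₂ (inj₁ ā)) (inj₂ (inj₁ b̄)) (inj₂ (inj₁ c̄)) =
    ⊥-elim ([ (λ a → ¬a (a , ā)) , [ (λ b → ¬b (b , b̄)) , (λ c → ¬c (c , c̄)) ] ] (triple k))
  split (inj₂ (inj₂ b)) (inj₂ (inj₂ c)) (inj₂ (inj₂ a)) =
    ⊥-elim ([ (λ ā → ¬a (a , ā)) , [ (λ b̄ → ¬b (b , b̄)) , (λ c̄ → ¬c (c , c̄)) ] ] (triple k̄))
  split (inj₂ (inj₁ ā)) (inj₂ _) (inj₂ (inj₂ a)) = contradiction (a , ā) ¬a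
  split (inj₂ (inj₂ b)) (inj₂ (inj₁ b̄)) (inj₂ _) = contradiction (b , b̄) ¬b
  split (inj₂ _) (inj₂ (inj₂ c)) (inj₂ (inj₁ c̄)) = contradiction (c , c̄) ¬c

-- The first two clauses resolve to `y`, the last two to `ȳ`.
core-unsatisfiable : {x x̄ y ȳ z z̄ : Set} → ¬ (x × x̄) → ¬ (y × ȳ) → ¬ (z × z̄) →
  x ⊎ x ⊎ y → x̄ ⊎ x̄ ⊎ y → ȳ ⊎ z ⊎ z → ȳ ⊎ z̄ ⊎ z̄ → ⊥
core-unsatisfiable {x} {x̄} {y} {ȳ} {z} {z̄} ¬x ¬y ¬z k₁ k₂ k₃ k₄ =
  resolve (merge k₁) (merge k₂) (reduce k₃) (reduce k₄)
  where
  merge : {p q : Set} → p ⊎ p ⊎ q → p ⊎ q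
  merge = [ inj₁ , id ]
  reduce : {p q : Set} → p ⊎ q ⊎ q → p ⊎ q
  reduce = Sum.map₂ [ id , id ]
  resolve : x ⊎ y → x̄ ⊎ y → ȳ ⊎ z → ȳ ⊎ z̄ → ⊥
  resolve (inj₁ x) (inj₁ x̄) _        _        = ¬x (x , x̄)
  resolve (inj₂ y) _        (inj₁ ȳ) _        = ¬y (y , ȳ)
  resolve (inj₂ y) _        (inj₂ _) (inj₁ ȳ) = ¬y (y , ȳ)
  resolve (inj₂ _) _        (inj₂ z) (inj₂ z̄) = ¬z (z , z̄)
  resolve (inj₁ _) (inj₂ y) (inj₁ ȳ) _        = ¬y (y , ȳ)
  resolve (inj₁ _) (inj₂ y) (inj₂ _) (inj₁ ȳ) = ¬y (y , ȳ)
  resolve (inj₁ _) (inj₂ _) (inj₂ z) (inj₂ z̄) = ¬z (z , z̄)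

clauseVertices : Fin 4 → List (Fin 50)
clauseVertices g = map (λ i → inner g (6 ↑ʳ i)) (allFin 5)

clauseVertices-unsaturated : ∀ g → All (λ v → ¬ Saturated M₀ v) (clauseVertices g)
clauseVertices-unsaturated = from-yes (Finₚ.all? λ g →
  all? (λ v → ¬? (any? (endpointOf? v) M₀)) (clauseVertices g))

no-dominatingTransversal : ¬ (∃[ T ] IsDominatingTransversal G M₀ T)
no-dominatingTransversal (T , (_ , transversal) , dominating) =
  -- No variable has both of its literals in `T`.
  refute (All.map (λ where
    (inj₁ (_ , v∉T)) (_ , v∈T) → v∉T v∈T
    (inj₂ (u∉T , _)) (u∈T , _) → u∉T u∈T) transversal)
  where
  -- A clause vertex is unsaturated, so `T` contains one of its literals. The table rows compute to
  -- the five clauses that `enforcer` expects.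
  satisfied : ∀ g → All (Any (_∈ₛ T)) (map nbrs (clauseVertices g))
  satisfied g = Allₚ.map⁺ (All.map (λ {v} ¬sat → case dominating v ¬sat of λ
    (u , u∈T , u∈) → lose u∈ u∈T) (clauseVertices-unsaturated g))
  refute : All (λ (u , v) → ¬ (u ∈ₛ T × v ∈ₛ T)) M₀ → ⊥
  refute (¬a₀ ∷ ¬b₀ ∷ ¬c₀ ∷ ¬a₁ ∷ ¬b₁ ∷ ¬c₁ ∷ ¬a₂ ∷ ¬b₂ ∷ ¬c₂ ∷ ¬a₃ ∷ ¬b₃ ∷ ¬c₃ ∷ ¬x ∷ ¬y ∷ ¬z ∷ []) =
    core-unsatisfiable ¬x ¬y ¬z
      (enforcer ¬a₀ ¬b₀ ¬c₀ (satisfied (# 0))) (enforcer ¬a₁ ¬b₁ ¬c₁ (satisfied (# 1)))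
      (enforcer ¬a₂ ¬b₂ ¬c₂ (satisfied (# 2))) (enforcer ¬a₃ ¬b₃ ¬c₃ (satisfied (# 3)))

theorem2 : Σ (Graph 50) λ G → Connected G × Cubic G ×
    (∃[ M ] (IsUniqueMinimumMaximalMatching G M × ¬ (∃[ T ] IsDominatingTransversal G M T))) ×
    IsDominationNumber G 14 × 14 < 15 × IsEdgeDominationNumber G 15
theorem2 = G , connected , cubic , (M₀ , M₀-unique , no-dominatingTransversal) ,
  dominationNumber , ≤-refl , edgeDominationNumber
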